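{- Let $\mathcal{K}=(\mathcal{T},\mathcal{A})$ be a knowledge base where $\mathcal{T}$ is consistent, $S$ the set of atomic concepts and atomic roles occurring in $\mathcal{A}$, and $D$ a delete request. Let $M^{S}$ be a $Neg(\mathcal{A})$-minimal model for $\mathcal{K}^{*}\cup\{Neg(D)\leftarrow\top\}$. Then $\mathcal{A}\setminus Del(M^{S})$ is a minimal instance deletion of $D$ from $\mathcal{A}$.
   Context: Knowledge bases are in the description logic $\mathcal{SHI}$: roles are atomic roles and their inverses; concepts are built from atomic concepts by $\top,\bot,\neg,\sqcap,\sqcup,\exists R.C,\forall R.C$; a TBox $\mathcal T$ is a finite set of inclusions $C\sqsubseteq D$ (the RBox, consisting of role inclusions and transitivity axioms, is suppressed in the notation $\mathcal K=(\mathcal T,\mathcal A)$); an ABox $\mathcal A$ is a finite set of assertions $A(a)$, $R(a,b)$ with $A$ an atomic concept, $R$ an atomic role, $a,b$ individuals. Interpretations, satisfaction, consistency (having a model) and entailment $\models$ are standard. DL-clauses: an atom is of the form $B(s)$, $R(s,t)$, $\exists R.B(s)$ or $\exists R.\neg B(s)$, with $B$ an atomic concept and $s,t$ individuals or variables; it is ground if it contains no variables. A DL-clause is $V_1\lor\dots\lor V_n\leftarrow U_1\land\dots\land U_m$ ($n,m\ge 0$) with $V_i$ atoms and $U_j$ atoms of the form $B(s)$ or $R(s,t)$; empty head is $\bot$, empty body $\top$. It is read as a universally quantified implication from the body to the head. A clause is also written $\mathbf H\leftarrow\mathbf B$ with head and body as sets of atoms. $\Xi(\mathcal T)$ denotes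 the set of DL-clauses obtained from $\mathcal T$ by the standard (structural) transformation of Motik, Shearer and Horrocks; it satisfies: for every interpretation $\mathcal I$, $\mathcal I\models\mathcal K$ iff $\mathcal I\models\Xi(\mathcal T)$ and $\mathcal I\models\mathcal A$. Symbol extraction: $\sigma(B(s))=B$, $\sigma(R(s,t))=R$, $\sigma(\exists R.B(s))=\exists R.B$ ($B$ an atomic or negated atomic concept). For each atomic concept or role $X$, $NegX$ and $ABoxX$ are new predicate symbols of the same arity; $Neg(A(a))=NegA(a)$, $Neg(R(a,b))=NegR(a,b)$, $ABox(A(a))=ABoxA(a)$, $ABox(R(a,b))=ABoxR(a,b)$; $Neg(\mathcal A)=\{Neg(A)\mid A\in\mathcal A\}$. Renaming: for a set $S$ of atomic concepts and atomic roles and $C=\mathbf H\leftarrow\mathbf B$, $\mathsf R_S(C)$ is the union of (1) $\{C\}$; (2) the single clause $\bigvee_{A\in\mathbf H,\sigma(A)\notin S}A\ \lor\ \bigvee_{B\in\mathbf B,\sigma(B)\in S}Neg(B)\ \leftarrow\ \bigwedge_{B\in\mathbf B,\sigma(B)\notin S}B\ \land\ \bigwedge_{A\in\mathbf H,\sigma(A)\in S}Neg(A)$; (3) all clauses $\bot\leftarrow R(x,y)\land NegR(x,y)$ for roles $R\in S$ such that some $A\in\mathbf H\cup\mathbf B$ has $\sigma(A)=R$ or some $A\in\mathbf H$ is of the form $\exists R.C(z)$ ($C$ an atomic or negated atomic concept); (4) all clauses $\bot\leftarrow D(x)\land NegD(x)$ for atomic concepts $D\in S$ such that some $A\in\mathbf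 H\cup\mathbf B$ has $\sigma(A)=D$ or some $A\in\mathbf H$ is of the form $\exists R.D(z)$. For a set $DL$ of DL-clauses, $\mathsf R_S(DL)=\bigcup_{C\in DL}\mathsf R_S(C)$. $\mathcal K^*$-transformation: with $S$ the set of atomic concepts and atomic roles occurring in $\mathcal A$, $\mathcal K^*=\mathsf R_{S}(\Xi(\mathcal T))\cup\{ABox(A)\leftarrow\top\mid A\in\mathcal A\}$. $\Gamma$-minimal model: an interpretation is identified with the set of ground atoms it makes true. For a set $DL$ of DL-clauses and a set $\Gamma$ of ground atoms, $\mathcal I$ is a $\Gamma$-minimal model for $DL$ iff $\mathcal I$ is a model for $DL$ and there is no model $\mathcal I'$ for $DL$ with $\mathcal I'\cap\Gamma\subset\mathcal I\cap\Gamma$ (strict inclusion). For a model $M$, $Del(M)=\{A\in\mathcal A\mid Neg(A)\in M\}$. Delete request / minimal instance deletion: a delete request is a ground atom $D\in\mathcal A$ of the form $A(a)$ or $R(a,b)$. $\mathcal A'\subseteq\mathcal A$ is a minimal instance deletion of $D$ from $\mathcal A$ if $\mathcal T\cup\mathcal A'\not\models D$ and there is no $\mathcal A''$ with $\mathcal A'\subset\mathcal A''\subseteq\mathcal A$ (first inclusion strict) and $\mathcal T\cup\mathcal A''\not\models D$.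
   Formalization: In Ξ(T), a filler ¬B in ∃R.¬B is replaced by a fresh name and transitivity axioms become clauses directly; with ¬B left in place the claim fails, e.g. T={A⊑∃R.¬B, A⊑∀R.B}, ABox {A(a),B(b)}, D=B(b). Renaming also counts R as occurring in ∃R⁻.C. -}

module Defs where

open import Data.List using (List; []; _∷_; _++_; map; mapMaybe; concatMap)
open import Data.List.Membership.Propositional using () renaming (_∈_ to _∈ₗ_)
open import Data.List.Relation.Unary.All using (All)
open import Data.List.Relation.Unary.Any using (Any)
open import Data.Bool using (Bool; true; false; _∨_; if_then_else_)
open import Data.Empty using (⊥)
open import Data.Maybe using (Maybe; just; nothing)
open import Data.Nat using (ℕ; suc)
open import Data.Product using (_×_; _,_; ∃-syntax)
open import Data.Sum using (_⊎_)
open import Data.Unit using (⊤)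
open import Level using (0ℓ)
open import Relation.Binary.PropositionalEquality using (_≡_)
open import Relation.Nullary using (¬_; does)
open import Relation.Unary
  using (Pred; Decidable; _∈_; _⊆_; _⊂_; _∩_; _∪_)

------------------------------------------------------------------------
-- Syntax and semantics of SHI

record Vocabulary : Set₁ where
  field
    ConName RoleName Ind : Set

open Vocabulary public

data Role (V : Vocabulary) : Set where
  atomic  : RoleName V → Role V
  inverse : RoleName V → Role V

roleName : ∀ {V} → Role V → RoleName V
roleName (atomic R)  = R
roleName (inverse R) = R

data Concept (V : Vocabulary) : Set where
  name        : ConName V → Concept V
  top bot     : Concept V
  not         : Concept V → Concept V
  _⊓_ _⊔_     : Concept V → Concept V → Concept V
  some∃ all∀  : Role V → Concept V → Concept V

record Inclusion (V : Vocabulary) : Set where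
  constructor _⊑_
  field
    lhs rhs : Concept V

data RoleAxiom (V : Vocabulary) : Set where
  _⊑ᵣ_       : Role V → Role V → RoleAxiom V
  transitive : Role V → RoleAxiom V

-- The RBox travels with the TBox, so that an ontology is (𝒯 , 𝒜).
record TBox (V : Vocabulary) : Set where
  field
    inclusions : List (Inclusion V)
    roleAxioms : List (RoleAxiom V)

open TBox public

-- B(s) and R(s,t), with arguments from an arbitrary set T of terms.
data BasicAtom (V : Vocabulary) (T : Set) : Set where
  con  : ConName V → T → BasicAtom V T
  role : RoleName V → T → T → BasicAtom V T

Assertion : Vocabulary → Set
Assertion V = BasicAtom V (Ind V)

record KnowledgeBase (V : Vocabulary) : Set where
  field
    tbox : TBox V
    abox : List (Assertion V)

record Interpretation (V : Vocabulary) : Set₁ where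
  field
    Δ     : Set
    point : Δ
    conᴵ  : ConName V → Pred Δ 0ℓ
    roleᴵ : RoleName V → Δ → Δ → Set
    indᴵ  : Ind V → Δ

open Interpretation public

module _ {V : Vocabulary} (I : Interpretation V) where

  ⟦_⟧ᵣ : Role V → Δ I → Δ I → Set
  ⟦ atomic R ⟧ᵣ  d e = roleᴵ I R d e
  ⟦ inverse R ⟧ᵣ d e = roleᴵ I R e d

  ⟦_⟧ : Concept V → Pred (Δ I) 0ℓ
  ⟦ name A ⟧    d = conᴵ I A d
  ⟦ top ⟧       d = ⊤
  ⟦ bot ⟧       d = ⊥
  ⟦ not C ⟧     d = ¬ ⟦ C ⟧ d
  ⟦ C ⊓ D ⟧     d = ⟦ C ⟧ d × ⟦ D ⟧ d
  ⟦ C ⊔ D ⟧     d = ⟦ C ⟧ d ⊎ ⟦ D ⟧ d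
  ⟦ some∃ R C ⟧ d = ∃[ e ] ⟦ R ⟧ᵣ d e × ⟦ C ⟧ e
  ⟦ all∀ R C ⟧  d = ∀ e → ⟦ R ⟧ᵣ d e → ⟦ C ⟧ e

  SatInclusion : Inclusion V → Set
  SatInclusion (C ⊑ D) = ⟦ C ⟧ ⊆ ⟦ D ⟧

  SatRoleAxiom : RoleAxiom V → Set
  SatRoleAxiom (R ⊑ᵣ S)  = ∀ d e → ⟦ R ⟧ᵣ d e → ⟦ S ⟧ᵣ d e
  SatRoleAxiom (transitive R) =
    ∀ d e f → ⟦ R ⟧ᵣ d e → ⟦ R ⟧ᵣ e f → ⟦ R ⟧ᵣ d f

  SatTBox : TBox V → Set
  SatTBox 𝒯 = All SatInclusion (inclusions 𝒯) × All SatRoleAxiom (roleAxioms 𝒯)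

  SatBasic : {T : Set} → (T → Δ I) → BasicAtom V T → Set
  SatBasic ρ (con A s)    = conᴵ I A (ρ s)
  SatBasic ρ (role R s t) = roleᴵ I R (ρ s) (ρ t)

  SatAssertion : Assertion V → Set
  SatAssertion = SatBasic (indᴵ I)

  -- Sub-ABoxes of a finite ABox are given as subsets, hence as predicates.
  SatABox : Pred (Assertion V) 0ℓ → Set
  SatABox 𝒜 = ∀ α → α ∈ 𝒜 → SatAssertion α

Consistent : ∀ {V} → TBox V → Set₁
Consistent {V} 𝒯 = ∃[ I ] SatTBox {V} I 𝒯

Entails : ∀ {V} → TBox V → Pred (Assertion V) 0ℓ → Assertion V → Set₁
Entails {V} 𝒯 𝒜 α =
  (I : Interpretation V) → SatTBox I 𝒯 → SatABox I 𝒜 → SatAssertion I α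

------------------------------------------------------------------------
-- DL-clauses

data Literal (V : Vocabulary) : Set where
  pos neg : ConName V → Literal V

data Atom (V : Vocabulary) (T : Set) : Set where
  basic : BasicAtom V T → Atom V T
  ex    : Role V → Literal V → T → Atom V T

data Term (V : Vocabulary) : Set where
  ind : Ind V → Term V
  var : ℕ → Term V

record DLClause (V : Vocabulary) : Set where
  constructor _⟵_
  field
    head : List (Atom V (Term V))
    body : List (BasicAtom V (Term V))

open DLClause public

infix 4 _⟵_

ClauseSet : Vocabulary → Set₁
ClauseSet V = Pred (DLClause V) 0ℓ

GroundAtom : Vocabulary → Set
GroundAtom V = Atom V (Ind V)

module _ {V : Vocabulary} (I : Interpretation V) where

  SatLiteral : Literal V → Pred (Δ I) 0ℓ
  SatLiteral (pos A) d = conᴵ I A d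
  SatLiteral (neg A) d = ¬ conᴵ I A d

  SatAtom : {T : Set} → (T → Δ I) → Atom V T → Set
  SatAtom ρ (basic α)  = SatBasic I ρ α
  SatAtom ρ (ex R L s) = ∃[ e ] ⟦_⟧ᵣ I R (ρ s) e × SatLiteral L e

  evalTerm : (ℕ → Δ I) → Term V → Δ I
  evalTerm ρ (ind a) = indᴵ I a
  evalTerm ρ (var x) = ρ x

  SatClause : DLClause V → Set
  SatClause C = (ρ : ℕ → Δ I) →
    All (SatBasic I (evalTerm ρ)) (body C) →
    Any (SatAtom (evalTerm ρ)) (head C)

  SatClauses : ClauseSet V → Set
  SatClauses DL = ∀ C → C ∈ DL → SatClause C

  trueAtoms : Pred (GroundAtom V) 0ℓ
  trueAtoms = SatAtom (indᴵ I)

MinimalModel : ∀ {V} → Pred (GroundAtom V) 0ℓ → ClauseSet V →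
               Interpretation V → Set₁
MinimalModel {V} Γ DL I =
  SatClauses I DL ×
  ¬ (∃[ I′ ] SatClauses {V} I′ DL × (trueAtoms I′ ∩ Γ) ⊂ (trueAtoms I ∩ Γ))

------------------------------------------------------------------------
-- The structural transformation Ξ

data NNF (V : Vocabulary) : Set where
  lit         : Literal V → NNF V
  top bot     : NNF V
  _⊓_ _⊔_     : NNF V → NNF V → NNF V
  some∃ all∀  : Role V → NNF V → NNF V

nnf  : ∀ {V} → Concept V → NNF V
nnf¬ : ∀ {V} → Concept V → NNF V

nnf (name A)    = lit (pos A)
nnf top         = top
nnf bot         = bot
nnf (not C)     = nnf¬ C
nnf (C ⊓ D)     = nnf C ⊓ nnf D
nnf (C ⊔ D)     = nnf C ⊔ nnf D
nnf (some∃ R C) = some∃ R (nnf C)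
nnf (all∀ R C)  = all∀ R (nnf C)

nnf¬ (name A)    = lit (neg A)
nnf¬ top         = bot
nnf¬ bot         = top
nnf¬ (not C)     = nnf C
nnf¬ (C ⊓ D)     = nnf¬ C ⊔ nnf¬ D
nnf¬ (C ⊔ D)     = nnf¬ C ⊓ nnf¬ D
nnf¬ (some∃ R C) = all∀ R (nnf¬ C)
nnf¬ (all∀ R C)  = some∃ R (nnf¬ C)

-- The clauses of Ξ(𝒯) use, besides the names of 𝒯, a fresh atomic concept
-- Q C for every concept C in negation normal form.
data FreshName (V : Vocabulary) : Set where
  old : ConName V → FreshName V
  Q   : NNF V → FreshName V

Fresh : Vocabulary → Vocabulary
Fresh V = record { ConName = FreshName V ; RoleName = RoleName V ; Ind = Ind V }

embed : ∀ {V T} → BasicAtom V T → BasicAtom (Fresh V) T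
embed (con A s)    = con (old A) s
embed (role R s t) = role R s t

embedRole : ∀ {V} → Role V → Role (Fresh V)
embedRole (atomic R)  = atomic R
embedRole (inverse R) = inverse R

embedLiteral : ∀ {V} → Literal V → Literal (Fresh V)
embedLiteral (pos A) = pos (old A)
embedLiteral (neg A) = neg (old A)

complement : ∀ {V} → Literal V → Literal V
complement (pos A) = neg A
complement (neg A) = pos A

-- The polarity of Motik, Shearer and Horrocks.  Naming C by ¬ Q C when it is
-- false keeps Horn inclusions Horn.
positive : ∀ {V} → NNF V → Bool
positive (lit (pos _)) = true
positive (lit (neg _)) = false
positive top           = false
positive bot           = false
positive (C ⊓ D)       = positive C ∨ positive D
positive (C ⊔ D)       = positive C ∨ positive D
positive (some∃ _ _)   = true
positive (all∀ _ C)    = positive C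

α : ∀ {V} → NNF V → Literal (Fresh V)
α C = if positive C then pos (Q C) else neg (Q C)

-- A normalised inclusion ⊤ ⊑ D₁ ⊔ … ⊔ Dₙ is the list of its disjuncts.
data Disjunct (V : Vocabulary) : Set where
  lit        : Literal V → Disjunct V
  some∃ all∀ : Role V → Literal V → Disjunct V

-- The literal standing for C as the filler of ∃R.C or ∀R.C.  Literal fillers
-- are kept, except that negative ones below ∃ are named like complex
-- concepts.  Thus a head atom ∃R.¬B has a fresh B; the renaming below leaves
-- such atoms untouched and is not sound for them if B is a renamed name.
∃filler : ∀ {V} → NNF V → Literal (Fresh V)
∃filler (lit (pos A)) = pos (old A)
∃filler C             = α C

∀filler : ∀ {V} → NNF V → Literal (Fresh V)
∀filler (lit L) = embedLiteral L
∀filler C       = α C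

-- ⊤ is treated as the empty conjunction and ⊥ as the empty disjunction.
disjuncts : ∀ {V} → NNF V → List (Disjunct (Fresh V))
disjuncts (lit L)     = lit (embedLiteral L) ∷ []
disjuncts top         = lit (α top) ∷ []
disjuncts bot         = []
disjuncts (C ⊓ D)     = lit (α (C ⊓ D)) ∷ []
disjuncts (C ⊔ D)     = disjuncts C ++ disjuncts D
disjuncts (some∃ R C) = some∃ (embedRole R) (∃filler C) ∷ []
disjuncts (all∀ R C)  = all∀ (embedRole R) (∀filler C) ∷ []

-- definitions C lists the normalised inclusions ⊤ ⊑ ¬ α(E) ⊔ … that define
-- the fresh names used in disjuncts C, and recursively those used in these.
mutual

  definitions : ∀ {V} → NNF V → List (List (Disjunct (Fresh V)))
  definitions (lit _)     = []
  definitions top         = []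
  definitions bot         = []
  definitions (C ⊓ D)     =
    (lit (complement (α (C ⊓ D))) ∷ disjuncts C) ∷
    (lit (complement (α (C ⊓ D))) ∷ disjuncts D) ∷
    definitions C ++ definitions D
  definitions (C ⊔ D)     = definitions C ++ definitions D
  definitions (some∃ R C) = ∃definitions C
  definitions (all∀ R C)  = ∀definitions C

  ∃definitions : ∀ {V} → NNF V → List (List (Disjunct (Fresh V)))
  ∃definitions (lit (pos A)) = []
  ∃definitions C = (lit (complement (α C)) ∷ disjuncts C) ∷ definitions C

  ∀definitions : ∀ {V} → NNF V → List (List (Disjunct (Fresh V)))
  ∀definitions (lit _) = []
  ∀definitions C = (lit (complement (α C)) ∷ disjuncts C) ∷ definitions C

normalise : ∀ {V} → Inclusion V → List (List (Disjunct (Fresh V)))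
normalise (C ⊑ D) =
  disjuncts (nnf¬ C ⊔ nnf D) ∷ definitions (nnf¬ C ⊔ nnf D)

roleAtom : ∀ {V T} → Role V → T → T → BasicAtom V T
roleAtom (atomic R)  s t = role R s t
roleAtom (inverse R) s t = role R t s

-- All disjuncts are about the variable 0; the i-th one, if it is a universal
-- restriction, speaks about its successors by the variable i.
disjunctAt : ∀ {V} → ℕ → Disjunct V → DLClause V
disjunctAt i (lit (pos A))    = basic (con A (var 0)) ∷ [] ⟵ []
disjunctAt i (lit (neg A))    = [] ⟵ con A (var 0) ∷ []
disjunctAt i (some∃ R L)      = ex R L (var 0) ∷ [] ⟵ []
disjunctAt i (all∀ R (pos A)) =
  basic (con A (var i)) ∷ [] ⟵ roleAtom R (var 0) (var i) ∷ []
disjunctAt i (all∀ R (neg A)) =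
  [] ⟵ roleAtom R (var 0) (var i) ∷ con A (var i) ∷ []

clausifyFrom : ∀ {V} → ℕ → List (Disjunct V) → DLClause V
clausifyFrom i []       = [] ⟵ []
clausifyFrom i (d ∷ ds) =
  head (disjunctAt i d) ++ head (clausifyFrom (suc i) ds)
    ⟵ body (disjunctAt i d) ++ body (clausifyFrom (suc i) ds)

clausify : ∀ {V} → List (Disjunct V) → DLClause V
clausify = clausifyFrom 1

roleClause : ∀ {V} → RoleAxiom V → DLClause (Fresh V)
roleClause (R ⊑ᵣ S) =
  basic (roleAtom (embedRole S) (var 0) (var 1)) ∷ []
    ⟵ roleAtom (embedRole R) (var 0) (var 1) ∷ []
roleClause (transitive R) =
  basic (roleAtom (embedRole R) (var 0) (var 2)) ∷ []
    ⟵ roleAtom (embedRole R) (var 0) (var 1) ∷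
       roleAtom (embedRole R) (var 1) (var 2) ∷ []

Ξ : ∀ {V} → TBox V → ClauseSet (Fresh V)
Ξ 𝒯 C = C ∈ₗ map clausify (concatMap normalise (inclusions 𝒯)) ++
            map roleClause (roleAxioms 𝒯)

------------------------------------------------------------------------
-- Renaming

data Marked (X : Set) : Set where
  plain Neg ABox : X → Marked X

Star : Vocabulary → Vocabulary
Star V = record
  { ConName  = Marked (ConName V)
  ; RoleName = Marked (RoleName V)
  ; Ind      = Ind V
  }

module _ {V : Vocabulary} where

  mark : {T : Set} → (∀ {X} → X → Marked X) →
         BasicAtom V T → BasicAtom (Star V) T
  mark m (con A s)    = con (m A) s
  mark m (role R s t) = role (m R) s t

  plainTerm : Term V → Term (Star V)
  plainTerm (ind a) = ind a
  plainTerm (var x) = var x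

  mapBasic : {T U : Set} → (T → U) → BasicAtom V T → BasicAtom V U
  mapBasic f (con A s)    = con A (f s)
  mapBasic f (role R s t) = role R (f s) (f t)

  markᵗ : (∀ {X} → X → Marked X) →
          BasicAtom V (Term V) → BasicAtom (Star V) (Term (Star V))
  markᵗ m β = mark m (mapBasic plainTerm β)

  plainRole : Role V → Role (Star V)
  plainRole (atomic R)  = atomic (plain R)
  plainRole (inverse R) = inverse (plain R)

  plainLiteral : Literal V → Literal (Star V)
  plainLiteral (pos A) = pos (plain A)
  plainLiteral (neg A) = neg (plain A)

  plainAtom : Atom V (Term V) → Atom (Star V) (Term (Star V))
  plainAtom (basic β)  = basic (markᵗ plain β)
  plainAtom (ex R L s) = ex (plainRole R) (plainLiteral L) (plainTerm s)

  plainClause : DLClause V → DLClause (Star V)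
  plainClause (H ⟵ B) = map plainAtom H ⟵ map (markᵗ plain) B

data Symbol (V : Vocabulary) : Set where
  con  : ConName V → Symbol V
  role : RoleName V → Symbol V

σ : ∀ {V T} → BasicAtom V T → Symbol V
σ (con A _)    = con A
σ (role R _ _) = role R

module Renaming {V : Vocabulary} {S : Pred (Symbol V) 0ℓ} (S? : Decidable S) where

  -- The symbol ∃R.B of an existential atom is never in S, a set of atomic
  -- concepts and atomic roles.
  keptHead : Atom V (Term V) → Maybe (Atom (Star V) (Term (Star V)))
  keptHead (basic β)  =
    if does (S? (σ β)) then nothing else just (plainAtom (basic β))
  keptHead (ex R L s) = just (plainAtom (ex R L s))

  movedHead : Atom V (Term V) → Maybe (BasicAtom (Star V) (Term (Star V)))
  movedHead (basic β)  = if does (S? (σ β)) then just (markᵗ Neg β) else nothing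
  movedHead (ex _ _ _) = nothing

  keptBody : BasicAtom V (Term V) → Maybe (BasicAtom (Star V) (Term (Star V)))
  keptBody β = if does (S? (σ β)) then nothing else just (markᵗ plain β)

  movedBody : BasicAtom V (Term V) → Maybe (Atom (Star V) (Term (Star V)))
  movedBody β = if does (S? (σ β)) then just (basic (markᵗ Neg β)) else nothing

  renamed : DLClause V → DLClause (Star V)
  renamed (H ⟵ B) = mapMaybe keptHead H ++ mapMaybe movedBody B
                  ⟵ mapMaybe keptBody B ++ mapMaybe movedHead H

  -- An inverse role ∃R⁻.B counts as an occurrence of R; a concept name counts
  -- below ∃ only if it is not negated.
  Mentions : Symbol V → Atom V (Term V) → Set
  Mentions X (basic β)        = σ β ≡ X
  Mentions X (ex R (pos B) _) = X ≡ role (roleName R) ⊎ X ≡ con B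
  Mentions X (ex R (neg _) _) = X ≡ role (roleName R)

  OccursIn : Symbol V → DLClause V → Set
  OccursIn X C = Any (Mentions X) (head C) ⊎ Any (λ β → σ β ≡ X) (body C)

  disjointness : Symbol V → DLClause (Star V)
  disjointness (con A)  =
    [] ⟵ con (plain A) (var 0) ∷ con (Neg A) (var 0) ∷ []
  disjointness (role R) =
    [] ⟵ role (plain R) (var 0) (var 1) ∷ role (Neg R) (var 0) (var 1) ∷ []

  data ℛ (DL : ClauseSet V) : ClauseSet (Star V) where
    original : ∀ {C} → C ∈ DL → ℛ DL (plainClause C)
    modified : ∀ {C} → C ∈ DL → ℛ DL (renamed C)
    disjoint : ∀ {C X} → C ∈ DL → X ∈ S → OccursIn X C → ℛ DL (disjointness X)

open Renaming public using (ℛ)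

------------------------------------------------------------------------
-- 𝒦* and instance deletion

symbolsOf : ∀ {V} → List (Assertion V) → Pred (Symbol (Fresh V)) 0ℓ
symbolsOf 𝒜 X = X ∈ₗ map (λ β → σ (embed β)) 𝒜

NegA ABoxA : ∀ {V} → Assertion V → Assertion (Star (Fresh V))
NegA β  = mark Neg (embed β)
ABoxA β = mark ABox (embed β)

groundTerm : ∀ {V} → BasicAtom V (Ind V) → BasicAtom V (Term V)
groundTerm = mapBasic ind

fact : ∀ {V} → Assertion V → DLClause V
fact β = basic (groundTerm β) ∷ [] ⟵ []

_* : ∀ {V} (K : KnowledgeBase V) → Decidable (symbolsOf (KnowledgeBase.abox K)) →
     ClauseSet (Star (Fresh V))
(K *) S? = ℛ S? (Ξ tbox) ∪ (λ C → ∃[ β ] β ∈ₗ abox × C ≡ fact (ABoxA β))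
  where open KnowledgeBase K

NegSet : ∀ {V} → List (Assertion V) → Pred (GroundAtom (Star (Fresh V))) 0ℓ
NegSet 𝒜 γ = ∃[ β ] β ∈ₗ 𝒜 × γ ≡ basic (NegA β)

Del : ∀ {V} → List (Assertion V) → Interpretation (Star (Fresh V)) →
      Pred (Assertion V) 0ℓ
Del 𝒜 M β = β ∈ₗ 𝒜 × basic (NegA β) ∈ trueAtoms M

MinimalInstanceDeletion : ∀ {V} → TBox V → List (Assertion V) → Assertion V →
                          Pred (Assertion V) 0ℓ → Set₁
MinimalInstanceDeletion {V} 𝒯 𝒜 D 𝒜′ =
  𝒜′ ⊆ (_∈ₗ 𝒜) × ¬ Entails 𝒯 𝒜′ D ×
  ¬ (∃[ 𝒜″ ] 𝒜′ ⊂ 𝒜″ × 𝒜″ ⊆ (_∈ₗ 𝒜) × ¬ Entails {V} 𝒯 𝒜″ D)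

{-# OPTIONS --safe #-}
-- From a model M of 𝒦* ∪ {Neg(D)} one reads off a model of 𝒯 by interpreting
-- every X ∈ S as the complement of NegX and keeping the other names: the renamed
-- clauses then say what the original ones do, and the disjointness clauses carry
-- the head atoms ∃R.B over.  The assertions of 𝒜 true in it are those not in
-- Del(M), so it satisfies 𝒜 ∖ Del(M) and refutes D.  Conversely, a model of 𝒯 and a
-- larger 𝒜″ refuting D becomes, with NegX as the complement of X and ABoxX
-- always true, a model of 𝒦* ∪ {Neg(D)} with strictly fewer atoms of Neg(𝒜),
-- which contradicts the minimality of M.
module Submission where

open import Defs
open import Axiom.ExcludedMiddle using (ExcludedMiddle)
open import Data.Bool using (true; false; if_then_else_)
open import Data.Empty using (⊥)
open import Data.List as List using (List; []; _∷_; catMaybes; mapMaybe)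
open import Data.List.Membership.Propositional using (lose) renaming (_∈_ to _∈ₗ_)
open import Data.List.Membership.Propositional.Properties using (∈-map⁺; ∈-map⁻)
open import Data.List.Relation.Unary.All as All using (All; []; _∷_)
import Data.List.Relation.Unary.All.Properties as Allₚ
open import Data.List.Relation.Unary.Any as Any using (Any; here; there)
import Data.List.Relation.Unary.Any.Properties as Anyₚ
open import Data.Maybe using (Maybe; just; nothing)
import Data.Maybe.Relation.Unary.All as Maybe
open import Data.Nat using (ℕ; zero; suc; _+_)
open import Data.Nat.Properties using (+-identityʳ; +-suc)
open import Data.Product using (∃-syntax; _×_; _,_; proj₁; proj₂)
open import Data.Sum using (_⊎_; inj₁; inj₂; [_,_]′)
open import Data.Unit using (⊤; tt)
open import Function using (id; _∘_)
open import Level using (0ℓ)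
open import Relation.Binary.PropositionalEquality using (_≡_; refl; sym; trans; cong; cong₂; subst)
open import Relation.Nullary using (¬_; yes; no; does; contradiction)
open import Relation.Nullary.Decidable using (decidable-stable)
open import Relation.Unary using (Pred; Decidable; _∈_; _∉_; _⊆_; _⊂_; _∪_; _∖_; ｛_｝)

-- Negation normal form

module _ {V : Vocabulary} (I : Interpretation V) where

  ⟦_⟧ⁿ : NNF V → Pred (Δ I) 0ℓ
  ⟦ lit L ⟧ⁿ     d = SatLiteral I L d
  ⟦ top ⟧ⁿ       d = ⊤
  ⟦ bot ⟧ⁿ       d = ⊥
  ⟦ C ⊓ D ⟧ⁿ     d = ⟦ C ⟧ⁿ d × ⟦ D ⟧ⁿ d
  ⟦ C ⊔ D ⟧ⁿ     d = ⟦ C ⟧ⁿ d ⊎ ⟦ D ⟧ⁿ d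
  ⟦ some∃ R C ⟧ⁿ d = ∃[ e ] ⟦_⟧ᵣ I R d e × ⟦ C ⟧ⁿ e
  ⟦ all∀ R C ⟧ⁿ  d = ∀ e → ⟦_⟧ᵣ I R d e → ⟦ C ⟧ⁿ e

  -- Mutual, since `not` exchanges the two translations. This direction is constructive.
  nnf-sound  : ∀ C {d} → ⟦ nnf C ⟧ⁿ d → ⟦_⟧ I C d
  nnf¬-sound : ∀ C {d} → ⟦ nnf¬ C ⟧ⁿ d → ¬ ⟦_⟧ I C d

  nnf-sound (name A)    c           = c
  nnf-sound top         c           = c
  nnf-sound bot         c           = c
  nnf-sound (not C)     c           = nnf¬-sound C c
  nnf-sound (C ⊓ D)     (c , d)     = nnf-sound C c , nnf-sound D d
  nnf-sound (C ⊔ D)     (inj₁ c)    = inj₁ (nnf-sound C c)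
  nnf-sound (C ⊔ D)     (inj₂ d)    = inj₂ (nnf-sound D d)
  nnf-sound (some∃ R C) (e , r , c) = e , r , nnf-sound C c
  nnf-sound (all∀ R C)  c e r       = nnf-sound C (c e r)

  nnf¬-sound (name A)    n           c           = n c
  nnf¬-sound top         ()          c
  nnf¬-sound bot         n           ()
  nnf¬-sound (not C)     n           c           = c (nnf-sound C n)
  nnf¬-sound (C ⊓ D)     (inj₁ n)    (c , d)     = nnf¬-sound C n c
  nnf¬-sound (C ⊓ D)     (inj₂ n)    (c , d)     = nnf¬-sound D n d
  nnf¬-sound (C ⊔ D)     (m , n)     (inj₁ c)    = nnf¬-sound C m c
  nnf¬-sound (C ⊔ D)     (m , n)     (inj₂ d)    = nnf¬-sound D n d
  nnf¬-sound (some∃ R C) n           (e , r , c) = nnf¬-sound C (n e r) c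
  nnf¬-sound (all∀ R C)  (e , r , n) c           = nnf¬-sound C n (c e r)

-- Normalised inclusions

module _ {V : Vocabulary} (I : Interpretation V) where

  SatDisjunct : Δ I → Disjunct V → Set
  SatDisjunct d (lit L)     = SatLiteral I L d
  SatDisjunct d (some∃ R L) = ∃[ e ] ⟦_⟧ᵣ I R d e × SatLiteral I L e
  SatDisjunct d (all∀ R L)  = ∀ e → ⟦_⟧ᵣ I R d e → SatLiteral I L e

  SatDisjunction : List (Disjunct V) → Set
  SatDisjunction ds = ∀ d → Any (SatDisjunct d) ds

  complement-contradictory : ∀ L {d} → SatLiteral I (complement L) d → ¬ SatLiteral I L d
  complement-contradictory (pos A) n p = n p
  complement-contradictory (neg A) p n = n p

  -- An equality of types, so that `subst id` transports both ways; `roleAtom` reduces only once the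
  -- role is known to be atomic or inverse.
  sat-roleAtom : ∀ ρ R s t → SatBasic I (evalTerm I ρ) (roleAtom R s t) ≡
                 ⟦_⟧ᵣ I R (evalTerm I ρ s) (evalTerm I ρ t)
  sat-roleAtom ρ (atomic R)  s t = refl
  sat-roleAtom ρ (inverse R) s t = refl

  -- A true negative literal contradicts the body atom that encodes it; a true universal restriction
  -- is instantiated at `ρ i`.
  disjunctAt-complete : ∀ i D ρ → SatDisjunct (ρ 0) D →
    All (SatBasic I (evalTerm I ρ)) (body (disjunctAt i D)) →
    Any (SatAtom I (evalTerm I ρ)) (head (disjunctAt i D))
  disjunctAt-complete i (lit (pos A))    ρ p []           = here p
  disjunctAt-complete i (lit (neg A))    ρ n (p ∷ [])     = contradiction p n
  disjunctAt-complete i (some∃ R L)      ρ p []           = here p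
  disjunctAt-complete i (all∀ R (pos A)) ρ p (r ∷ []) =
    here (p _ (subst id (sat-roleAtom ρ R (var 0) (var i)) r))
  disjunctAt-complete i (all∀ R (neg A)) ρ n (r ∷ p ∷ []) =
    contradiction p (n _ (subst id (sat-roleAtom ρ R (var 0) (var i)) r))

  clausifyFrom-complete : ∀ i ds ρ → Any (SatDisjunct (ρ 0)) ds →
    All (SatBasic I (evalTerm I ρ)) (body (clausifyFrom i ds)) →
    Any (SatAtom I (evalTerm I ρ)) (head (clausifyFrom i ds))
  clausifyFrom-complete i (D ∷ ds) ρ (here p) bs =
    Anyₚ.++⁺ˡ (disjunctAt-complete i D ρ p (Allₚ.++⁻ˡ _ bs))
  clausifyFrom-complete i (D ∷ ds) ρ (there p) bs =
    Anyₚ.++⁺ʳ (head (disjunctAt i D))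
      (clausifyFrom-complete (suc i) ds ρ p (Allₚ.++⁻ʳ (body (disjunctAt i D)) bs))

  clausify-complete : ∀ {ds} → SatDisjunction ds → SatClause I (clausify ds)
  clausify-complete {ds} h ρ = clausifyFrom-complete 1 ds ρ (h (ρ 0))

  -- Only a universal restriction needs a counterexample `e`, which becomes the value of its clause
  -- variable; elsewhere `e` is a dummy.
  Refutes : Δ I → Disjunct V → Δ I → Set
  Refutes d (all∀ R L) e = ⟦_⟧ᵣ I R d e × ¬ SatLiteral I L e
  Refutes d D          e = ¬ SatDisjunct d D

  module _ (em : ExcludedMiddle 0ℓ) where

    -- The drinker paradox: the choice of e does not depend on a proof that D fails.
    refuter : ∀ d D → ∃[ e ] (¬ SatDisjunct d D → Refutes d D e)
    refuter d (lit L)     = d , id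
    refuter d (some∃ R L) = d , id
    refuter d (all∀ R L) with em {∃[ e ] ⟦_⟧ᵣ I R d e × ¬ SatLiteral I L e}
    ... | yes (e , p) = e , λ _ → p
    ... | no ∄e       = d , λ n → contradiction
      (λ e r → decidable-stable em λ ¬l → ∄e (e , r , ¬l)) n

    -- Position n, counted from 0, belongs to clause variable n + 1. Beyond the last disjunct the
    -- value defaults to `d`.
    refuters : Δ I → List (Disjunct V) → ℕ → Δ I
    refuters d []       n       = d
    refuters d (D ∷ ds) zero    = proj₁ (refuter d D)
    refuters d (D ∷ ds) (suc n) = refuters d ds n

    disjunctAt-refuted : ∀ i D ρ → Refutes (ρ 0) D (ρ i) →
      All (SatBasic I (evalTerm I ρ)) (body (disjunctAt i D)) ×
      ¬ Any (SatAtom I (evalTerm I ρ)) (head (disjunctAt i D))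
    disjunctAt-refuted i (lit (pos A)) ρ n = [] , λ { (here p) → n p }
    disjunctAt-refuted i (lit (neg A)) ρ n = decidable-stable em n ∷ [] , λ ()
    disjunctAt-refuted i (some∃ R L)   ρ n = [] , λ { (here p) → n p }
    disjunctAt-refuted i (all∀ R (pos A)) ρ (r , n) =
      subst id (sym (sat-roleAtom ρ R (var 0) (var i))) r ∷ [] , λ { (here p) → n p }
    disjunctAt-refuted i (all∀ R (neg A)) ρ (r , n) =
      subst id (sym (sat-roleAtom ρ R (var 0) (var i))) r ∷ decidable-stable em n ∷ [] , λ ()

    -- The equation is the induction invariant: the variables from `i` on carry the refuting values,
    -- while variable 0 stays fixed.
    clausifyFrom-refuted : ∀ i ds ρ → (∀ n → ρ (i + n) ≡ refuters (ρ 0) ds n) →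
      ¬ Any (SatDisjunct (ρ 0)) ds →
      All (SatBasic I (evalTerm I ρ)) (body (clausifyFrom i ds)) ×
      ¬ Any (SatAtom I (evalTerm I ρ)) (head (clausifyFrom i ds))
    clausifyFrom-refuted i []       ρ eq n = [] , λ ()
    clausifyFrom-refuted i (D ∷ ds) ρ eq n =
      Allₚ.++⁺ (proj₁ first) (proj₁ rest) ,
      [ proj₂ first , proj₂ rest ]′ ∘ Anyₚ.++⁻ (head (disjunctAt i D))
      where
      first = disjunctAt-refuted i D ρ
        (subst (Refutes (ρ 0) D) (trans (sym (eq 0)) (cong ρ (+-identityʳ i)))
          (proj₂ (refuter (ρ 0) D) (n ∘ here)))
      rest = clausifyFrom-refuted (suc i) ds ρ
        (λ k → trans (cong ρ (sym (+-suc i k))) (eq (suc k))) (n ∘ there)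

    -- If all disjuncts fail at `d`, each universal restriction fails at some successor. As each has
    -- a variable of its own, a single assignment makes the whole body true and the whole head
    -- false.
    clausify-sound : ∀ {ds} → SatClause I (clausify ds) → SatDisjunction ds
    clausify-sound {ds} h d = decidable-stable em λ n →
      let bs , ¬hs = clausifyFrom-refuted 1 ds ρ (λ _ → refl) n in ¬hs (h ρ bs)
      where
      ρ : ℕ → Δ I
      ρ zero    = d
      ρ (suc n) = refuters d ds n

-- The structural transformation

definition : ∀ {V} → NNF V → List (Disjunct (Fresh V))
definition C = lit (complement (α C)) ∷ disjuncts C

-- A common view of the fillers below ∃ and ∀: either a literal is kept and nothing is defined, or
-- the concept is named and its definition is added. It replaces the repeated case split on `C`.
data Filler {V} : NNF V → Literal (Fresh V) → List (List (Disjunct (Fresh V))) → Set where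
  literal : ∀ L → Filler (lit L) (embedLiteral L) []
  named   : ∀ C → Filler C (α C) (definition C ∷ definitions C)

∃filler-view : ∀ {V} (C : NNF V) → Filler C (∃filler C) (∃definitions C)
∃filler-view (lit (pos A)) = literal (pos A)
∃filler-view (lit (neg A)) = named (lit (neg A))
∃filler-view top           = named top
∃filler-view bot           = named bot
∃filler-view (C ⊓ D)       = named (C ⊓ D)
∃filler-view (C ⊔ D)       = named (C ⊔ D)
∃filler-view (some∃ R C)   = named (some∃ R C)
∃filler-view (all∀ R C)    = named (all∀ R C)

∀filler-view : ∀ {V} (C : NNF V) → Filler C (∀filler C) (∀definitions C)
∀filler-view (lit L)     = literal L
∀filler-view top         = named top
∀filler-view bot         = named bot
∀filler-view (C ⊓ D)     = named (C ⊓ D)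
∀filler-view (C ⊔ D)     = named (C ⊔ D)
∀filler-view (some∃ R C) = named (some∃ R C)
∀filler-view (all∀ R C)  = named (all∀ R C)

-- From models of the clauses to models of the TBox

module _ {V : Vocabulary} (J : Interpretation (Fresh V)) where

  restrict : Interpretation V
  restrict = record
    { Δ     = Δ J
    ; point = point J
    ; conᴵ  = λ A → conᴵ J (old A)
    ; roleᴵ = roleᴵ J
    ; indᴵ  = indᴵ J
    }

  sat-embedRole : ∀ R {d e} → ⟦_⟧ᵣ J (embedRole R) d e ≡ ⟦_⟧ᵣ restrict R d e
  sat-embedRole (atomic R)  = refl
  sat-embedRole (inverse R) = refl

  sat-embedLiteral : ∀ L {d} → SatLiteral J (embedLiteral L) d ≡ SatLiteral restrict L d
  sat-embedLiteral (pos A) = refl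
  sat-embedLiteral (neg A) = refl

  sat-embed : ∀ β → SatAssertion J (embed β) ≡ SatAssertion restrict β
  sat-embed (con A s)    = refl
  sat-embed (role R s t) = refl

  -- The definitions only let the name `α C` imply `C`. This suffices, since `disjuncts` uses `α C`
  -- itself and its complement occurs only in definitions.
  disjuncts-sound : ∀ C → All (SatDisjunction J) (definitions C) →
    ∀ {d} → Any (SatDisjunct J d) (disjuncts C) → ⟦_⟧ⁿ restrict C d

  -- The named `E` may differ from `C`: the name of a conjunction has one defining inclusion for
  -- each conjunct.
  definition-sound : ∀ C {E} → SatDisjunction J (lit (complement (α E)) ∷ disjuncts C) →
    All (SatDisjunction J) (definitions C) →
    ∀ {d} → SatLiteral J (α E) d → ⟦_⟧ⁿ restrict C d

  filler-sound : ∀ C {L Ds} → Filler C L Ds → All (SatDisjunction J) Ds →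
    ∀ {d} → SatLiteral J L d → ⟦_⟧ⁿ restrict C d

  disjuncts-sound (lit L) hs (here l) = subst id (sat-embedLiteral L) l
  disjuncts-sound top hs p = tt
  disjuncts-sound bot hs ()
  disjuncts-sound (C ⊓ D) (h ∷ k ∷ hs) (here l) =
    definition-sound C h (Allₚ.++⁻ˡ (definitions C) hs) l ,
    definition-sound D k (Allₚ.++⁻ʳ (definitions C) hs) l
  disjuncts-sound (C ⊔ D) hs p with Anyₚ.++⁻ (disjuncts C) p
  ... | inj₁ q = inj₁ (disjuncts-sound C (Allₚ.++⁻ˡ (definitions C) hs) q)
  ... | inj₂ q = inj₂ (disjuncts-sound D (Allₚ.++⁻ʳ (definitions C) hs) q)
  disjuncts-sound (some∃ R C) hs (here (e , r , l)) =
    e , subst id (sat-embedRole R) r , filler-sound C (∃filler-view C) hs l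
  disjuncts-sound (all∀ R C) hs (here l) e r =
    filler-sound C (∀filler-view C) hs (l e (subst id (sym (sat-embedRole R)) r))

  definition-sound C {E} h hs {d} l with h d
  ... | here l̅  = contradiction l (complement-contradictory J (α E) l̅)
  ... | there p = disjuncts-sound C hs p

  filler-sound _ (literal L) hs       l = subst id (sat-embedLiteral L) l
  filler-sound C (named .C)  (h ∷ hs) l = definition-sound C h hs l

  normalise-sound : ∀ X → All (SatDisjunction J) (normalise X) → SatInclusion restrict X
  normalise-sound (C ⊑ D) (h ∷ hs) {d} c
    with disjuncts-sound (nnf¬ C ⊔ nnf D) hs (h d)
  ... | inj₁ n = contradiction c (nnf¬-sound restrict C n)
  ... | inj₂ p = nnf-sound restrict D p

  sat-embedRoleAtom : ∀ ρ R s t → SatBasic J (evalTerm J ρ) (roleAtom (embedRole R) s t)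
    ≡ ⟦_⟧ᵣ restrict R (evalTerm J ρ s) (evalTerm J ρ t)
  sat-embedRoleAtom ρ R s t = trans (sat-roleAtom J ρ (embedRole R) s t) (sat-embedRole R)

  roleClause-sound : ∀ X → SatClause J (roleClause X) → SatRoleAxiom restrict X
  roleClause-sound (R ⊑ᵣ S) h d e r
    with h ρ (subst id (sym (sat-embedRoleAtom ρ R (var 0) (var 1))) r ∷ [])
    where
    ρ : ℕ → Δ J
    ρ zero    = d
    ρ (suc _) = e
  ... | here s = subst id (sat-embedRoleAtom _ S (var 0) (var 1)) s
  roleClause-sound (transitive R) h d e f r s
    with h ρ (subst id (sym (sat-embedRoleAtom ρ R (var 0) (var 1))) r ∷
              subst id (sym (sat-embedRoleAtom ρ R (var 1) (var 2))) s ∷ [])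
    where
    ρ : ℕ → Δ J
    ρ zero          = d
    ρ (suc zero)    = e
    ρ (suc (suc _)) = f
  ... | here t = subst id (sat-embedRoleAtom _ R (var 0) (var 2)) t

  roleClause-complete : ∀ X → SatRoleAxiom restrict X → SatClause J (roleClause X)
  roleClause-complete (R ⊑ᵣ S) h ρ (r ∷ []) =
    here (subst id (sym (sat-embedRoleAtom ρ S (var 0) (var 1)))
      (h _ _ (subst id (sat-embedRoleAtom ρ R (var 0) (var 1)) r)))
  roleClause-complete (transitive R) h ρ (r ∷ s ∷ []) =
    here (subst id (sym (sat-embedRoleAtom ρ R (var 0) (var 2)))
      (h _ _ _ (subst id (sat-embedRoleAtom ρ R (var 0) (var 1)) r)
               (subst id (sat-embedRoleAtom ρ R (var 1) (var 2)) s)))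

  Ξ-sound : ExcludedMiddle 0ℓ → ∀ 𝒯 → SatClauses J (Ξ 𝒯) → SatTBox restrict 𝒯
  Ξ-sound em 𝒯 h =
    All.map (λ {X} → normalise-sound X ∘ All.map (clausify-sound J em))
      (Allₚ.map⁻ (Allₚ.concat⁻ (Allₚ.map⁻ (Allₚ.++⁻ˡ _ clauses)))) ,
    All.map (λ {X} → roleClause-sound X) (Allₚ.map⁻ (Allₚ.++⁻ʳ _ clauses))
    where clauses = All.tabulate (λ {C} → h C)

-- From models of the TBox to models of the clauses

module _ {V : Vocabulary} (I : Interpretation V) where

  -- The polarity of `C` decides whether `Q C` denotes `C` or its complement, so that the literal
  -- `α C` classically means `C` in either case.
  extend : Interpretation (Fresh V)
  extend = record
    { Δ     = Δ I
    ; point = point I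
    ; conᴵ  = λ where
        (old A) → conᴵ I A
        (Q C)   → λ d → if positive C then ⟦_⟧ⁿ I C d else ¬ ⟦_⟧ⁿ I C d
    ; roleᴵ = roleᴵ I
    ; indᴵ  = indᴵ I
    }

  α-complete : ∀ C {d} → ⟦_⟧ⁿ I C d → SatLiteral extend (α C) d
  α-complete C c with positive C in eq
  -- Once `α C` has become a literal on `Q C`, the interpretation of `Q C` brings up `positive C`
  -- again.
  ... | true  rewrite eq = c
  ... | false rewrite eq = λ ¬c → ¬c c

  α-complement-complete : ∀ C {d} → ¬ ⟦_⟧ⁿ I C d → SatLiteral extend (complement (α C)) d
  α-complement-complete C ¬c with positive C in eq
  ... | true  rewrite eq = ¬c
  ... | false rewrite eq = ¬c

  filler-complete : ∀ {C L Ds} → Filler C L Ds → ∀ {d} → ⟦_⟧ⁿ I C d → SatLiteral extend L d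
  filler-complete (literal L) c = subst id (sym (sat-embedLiteral extend L)) c
  filler-complete (named C)   c = α-complete C c

  disjuncts-complete : ∀ C {d} → ⟦_⟧ⁿ I C d → Any (SatDisjunct extend d) (disjuncts C)
  disjuncts-complete (lit L)     c        = here (subst id (sym (sat-embedLiteral extend L)) c)
  disjuncts-complete top {d}     c        = here (α-complete top {d} c)
  disjuncts-complete (C ⊓ D)     c        = here (α-complete (C ⊓ D) c)
  disjuncts-complete (C ⊔ D)     (inj₁ c) = Anyₚ.++⁺ˡ (disjuncts-complete C c)
  disjuncts-complete (C ⊔ D)     (inj₂ d) = Anyₚ.++⁺ʳ (disjuncts C) (disjuncts-complete D d)
  disjuncts-complete (some∃ R C) (e , r , c) =
    here (e , subst id (sym (sat-embedRole extend R)) r , filler-complete (∃filler-view C) c)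
  disjuncts-complete (all∀ R C)  c =
    here λ e r → filler-complete (∀filler-view C) (c e (subst id (sat-embedRole extend R) r))

  module _ (em : ExcludedMiddle 0ℓ) where

    -- Classical, unlike the converse: a failing conjunction must yield a failing conjunct, and a
    -- failing universal restriction a witness.
    nnf-complete  : ∀ C {d} → ⟦_⟧ I C d → ⟦_⟧ⁿ I (nnf C) d
    nnf¬-complete : ∀ C {d} → ¬ ⟦_⟧ I C d → ⟦_⟧ⁿ I (nnf¬ C) d

    nnf-complete (name A)    c           = c
    nnf-complete top         c           = c
    nnf-complete bot         c           = c
    nnf-complete (not C)     c           = nnf¬-complete C c
    nnf-complete (C ⊓ D)     (c , d)     = nnf-complete C c , nnf-complete D d
    nnf-complete (C ⊔ D)     (inj₁ c)    = inj₁ (nnf-complete C c)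
    nnf-complete (C ⊔ D)     (inj₂ d)    = inj₂ (nnf-complete D d)
    nnf-complete (some∃ R C) (e , r , c) = e , r , nnf-complete C c
    nnf-complete (all∀ R C)  c e r       = nnf-complete C (c e r)

    nnf¬-complete (name A)    n = n
    nnf¬-complete top         n = n tt
    nnf¬-complete bot         n = tt
    nnf¬-complete (not C)     n = nnf-complete C (decidable-stable em n)
    nnf¬-complete (C ⊓ D) {d} n with em {⟦_⟧ I C d}
    ... | yes c = inj₂ (nnf¬-complete D λ c′ → n (c , c′))
    ... | no ¬c = inj₁ (nnf¬-complete C ¬c)
    nnf¬-complete (C ⊔ D)     n = nnf¬-complete C (n ∘ inj₁) , nnf¬-complete D (n ∘ inj₂)
    nnf¬-complete (some∃ R C) n = λ e r → nnf¬-complete C λ c → n (e , r , c)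
    nnf¬-complete (all∀ R C)  {d} n with em {∃[ e ] ⟦_⟧ᵣ I R d e × ¬ ⟦_⟧ I C e}
    ... | yes (e , r , ¬c) = e , r , nnf¬-complete C ¬c
    ... | no ∄e            = contradiction
      (λ e r → decidable-stable em λ ¬c → ∄e (e , r , ¬c)) n

    definition-complete : ∀ C E → ⟦_⟧ⁿ I E ⊆ ⟦_⟧ⁿ I C →
      SatDisjunction extend (lit (complement (α E)) ∷ disjuncts C)
    definition-complete C E E⊆C d with em {⟦_⟧ⁿ I E d}
    ... | yes e = there (disjuncts-complete C (E⊆C e))
    ... | no ¬e = here (α-complement-complete E ¬e)

    definitions-complete : ∀ C → All (SatDisjunction extend) (definitions C)
    filler-definitions-complete : ∀ C {L Ds} → Filler C L Ds → All (SatDisjunction extend) Ds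

    definitions-complete (lit L)     = []
    definitions-complete top         = []
    definitions-complete bot         = []
    definitions-complete (C ⊓ D)     =
      definition-complete C (C ⊓ D) proj₁ ∷ definition-complete D (C ⊓ D) proj₂ ∷
      Allₚ.++⁺ (definitions-complete C) (definitions-complete D)
    definitions-complete (C ⊔ D)     = Allₚ.++⁺ (definitions-complete C) (definitions-complete D)
    definitions-complete (some∃ R C) = filler-definitions-complete C (∃filler-view C)
    definitions-complete (all∀ R C)  = filler-definitions-complete C (∀filler-view C)

    filler-definitions-complete _ (literal L) = []
    filler-definitions-complete C (named .C)  =
      definition-complete C C id ∷ definitions-complete C

    normalise-complete : ∀ X → SatInclusion I X → All (SatDisjunction extend) (normalise X)
    normalise-complete (C ⊑ D) h = first ∷ definitions-complete (nnf¬ C ⊔ nnf D)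
      where
      first : SatDisjunction extend (disjuncts (nnf¬ C ⊔ nnf D))
      first d with em {⟦_⟧ I C d}
      ... | yes c = disjuncts-complete (nnf¬ C ⊔ nnf D) (inj₂ (nnf-complete D (h c)))
      ... | no ¬c = disjuncts-complete (nnf¬ C ⊔ nnf D) (inj₁ (nnf¬-complete C ¬c))

    Ξ-complete : ∀ 𝒯 → SatTBox I 𝒯 → SatClauses extend (Ξ 𝒯)
    Ξ-complete 𝒯 (h , k) C = All.lookup (Allₚ.++⁺
      (Allₚ.map⁺ (Allₚ.concat⁺ (Allₚ.map⁺ (All.map
        (λ {X} → All.map (clausify-complete extend) ∘ normalise-complete X) h))))
      (Allₚ.map⁺ (All.map (λ {X} → roleClause-complete extend X) k)))

-- Renaming

-- Atoms moved to the other side of a clause give `nothing`, where `Maybe.All` is vacuous; facts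
-- about a renamed list thus return to the original one.
All-catMaybes⁻ : ∀ {A : Set} {P : Pred A 0ℓ} xs → All P (catMaybes xs) → All (Maybe.All P) xs
All-catMaybes⁻ []             ps       = []
All-catMaybes⁻ (nothing ∷ xs) ps       = Maybe.nothing ∷ All-catMaybes⁻ xs ps
All-catMaybes⁻ (just x ∷ xs)  (p ∷ ps) = Maybe.just p ∷ All-catMaybes⁻ xs ps

All-mapMaybe⁻ : ∀ {A B : Set} {P : Pred B 0ℓ} (f : A → Maybe B) xs →
  All P (mapMaybe f xs) → All (λ x → Maybe.All P (f x)) xs
All-mapMaybe⁻ f xs = Allₚ.map⁻ ∘ All-catMaybes⁻ (List.map f xs)

module _ {V : Vocabulary} (M : Interpretation (Star V)) where

  reinterpret : (ConName V → Pred (Δ M) 0ℓ) → (RoleName V → Δ M → Δ M → Set) →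
                Interpretation V
  reinterpret c r = record
    { Δ     = Δ M
    ; point = point M
    ; conᴵ  = c
    ; roleᴵ = r
    ; indᴵ  = indᴵ M
    }

  slice : (∀ {X : Set} → X → Marked X) → Interpretation V
  slice m = reinterpret (λ A → conᴵ M (m A)) (λ R → roleᴵ M (m R))

  sat-mark : (m : ∀ {X : Set} → X → Marked X) → ∀ {T : Set} (ρ : T → Δ M) β →
    SatBasic M ρ (mark m β) ≡ SatBasic (slice m) ρ β
  sat-mark m ρ (con A s)    = refl
  sat-mark m ρ (role R s t) = refl

  module _ (c : ConName V → Pred (Δ M) 0ℓ) (r : RoleName V → Δ M → Δ M → Set) where

    -- The value of a term depends on the assignment and the individuals alone, hence the arbitrary
    -- meanings `c` and `r` of the names.
    eval-plainTerm : ∀ ρ t → evalTerm M ρ (plainTerm t) ≡ evalTerm (reinterpret c r) ρ t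
    eval-plainTerm ρ (ind a) = refl
    eval-plainTerm ρ (var x) = refl

    sat-markᵗ : (m : ∀ {X : Set} → X → Marked X) → ∀ ρ β →
      SatBasic M (evalTerm M ρ) (markᵗ m β) ≡
      SatBasic (slice m) (evalTerm (reinterpret c r) ρ) β
    sat-markᵗ m ρ (con A s)    = cong (conᴵ M (m A)) (eval-plainTerm ρ s)
    sat-markᵗ m ρ (role R s t) =
      cong₂ (roleᴵ M (m R)) (eval-plainTerm ρ s) (eval-plainTerm ρ t)

-- A head atom ∃R.¬B with B ∈ S does not survive the renaming: plain B may be
-- false in M where NegB is false, too, that is, where unrename makes B true.
SafeLiteral : ∀ {V} → Pred (Symbol V) 0ℓ → Literal V → Set
SafeLiteral S (pos A) = ⊤
SafeLiteral S (neg A) = con A ∉ S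

SafeAtom : ∀ {V T} → Pred (Symbol V) 0ℓ → Atom V T → Set
SafeAtom S (basic β)  = ⊤
SafeAtom S (ex R L s) = SafeLiteral S L

module _ {V : Vocabulary} (J : Interpretation V) where

  star : Interpretation (Star V)
  star = record
    { Δ     = Δ J
    ; point = point J
    ; conᴵ  = λ where
        (plain A) → conᴵ J A
        (Neg A)   → λ d → ¬ conᴵ J A d
        (ABox A)  → λ _ → ⊤
    ; roleᴵ = λ where
        (plain R) → roleᴵ J R
        (Neg R)   → λ d e → ¬ roleᴵ J R d e
        (ABox R)  → λ _ _ → ⊤
    ; indᴵ  = indᴵ J
    }

  star-Neg : ∀ {T : Set} (ρ : T → Δ J) β → SatBasic star ρ (mark Neg β) ≡ (¬ SatBasic J ρ β)
  star-Neg ρ (con A s)    = refl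
  star-Neg ρ (role R s t) = refl

  star-ABox : ∀ {T : Set} (ρ : T → Δ J) β → SatBasic star ρ (mark ABox β)
  star-ABox ρ (con A s)    = tt
  star-ABox ρ (role R s t) = tt

  -- By η for records, `J` is both the plain slice of `star` and its reinterpretation with the names
  -- of `J`.
  star-plainᵗ : ∀ ρ β → SatBasic star (evalTerm star ρ) (markᵗ plain β) ≡
    SatBasic J (evalTerm J ρ) β
  star-plainᵗ = sat-markᵗ star (conᴵ J) (roleᴵ J) plain

  star-Negᵗ : ∀ ρ β → SatBasic star (evalTerm star ρ) (markᵗ Neg β) ≡
    (¬ SatBasic J (evalTerm J ρ) β)
  star-Negᵗ ρ β = trans (sat-markᵗ star (conᴵ J) (roleᴵ J) Neg ρ β)
    (trans (sym (sat-mark star Neg _ β)) (star-Neg _ β))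

  star-plainAtom : ∀ ρ A → SatAtom star (evalTerm star ρ) (plainAtom A) ≡
    SatAtom J (evalTerm J ρ) A
  star-plainAtom ρ (basic β) = star-plainᵗ ρ β
  star-plainAtom ρ (ex R L s) = trans (sat-ex R L _)
    (cong (λ d → ∃[ e ] ⟦_⟧ᵣ J R d e × SatLiteral J L e)
      (eval-plainTerm star (conᴵ J) (roleᴵ J) ρ s))
    where
    sat-ex : ∀ R L d → (∃[ e ] ⟦_⟧ᵣ star (plainRole R) d e × SatLiteral star (plainLiteral L) e) ≡
      (∃[ e ] ⟦_⟧ᵣ J R d e × SatLiteral J L e)
    sat-ex (atomic R)  (pos A) d = refl
    sat-ex (atomic R)  (neg A) d = refl
    sat-ex (inverse R) (pos A) d = refl
    sat-ex (inverse R) (neg A) d = refl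

module _ {V : Vocabulary} {S : Pred (Symbol V) 0ℓ} (S? : Decidable S) where

  open Renaming S? using (keptHead; movedHead; keptBody; movedBody; Mentions; disjointness)

  -- From models of the renamed clauses to models of the original ones

  module _ (M : Interpretation (Star V)) where

    unrename : Interpretation V
    unrename = reinterpret M
      (λ A d → if does (S? (con A)) then ¬ conᴵ M (Neg A) d else conᴵ M (plain A) d)
      (λ R d e → if does (S? (role R)) then ¬ roleᴵ M (Neg R) d e else roleᴵ M (plain R) d e)

    unrename-∉ : ∀ {T : Set} (ρ : T → Δ M) β → σ β ∉ S →
      SatBasic unrename ρ β ≡ SatBasic (slice M plain) ρ β
    unrename-∉ ρ (con A s) β∉S with S? (con A)
    ... | yes β∈S = contradiction β∈S β∉S
    ... | no _    = refl
    unrename-∉ ρ (role R s t) β∉S with S? (role R)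
    ... | yes β∈S = contradiction β∈S β∉S
    ... | no _    = refl

    unrename-∈ : ∀ {T : Set} (ρ : T → Δ M) β → σ β ∈ S →
      SatBasic unrename ρ β ≡ (¬ SatBasic (slice M Neg) ρ β)
    unrename-∈ ρ (con A s) β∈S with S? (con A)
    ... | yes _  = refl
    ... | no β∉S = contradiction β∈S β∉S
    unrename-∈ ρ (role R s t) β∈S with S? (role R)
    ... | yes _  = refl
    ... | no β∉S = contradiction β∈S β∉S

    unrename-kept : ∀ ρ β → σ β ∉ S → SatBasic unrename (evalTerm unrename ρ) β ≡
      SatBasic M (evalTerm M ρ) (markᵗ plain β)
    unrename-kept ρ β β∉S = trans (unrename-∉ _ β β∉S) (sym (sat-markᵗ M _ _ plain ρ β))

    unrename-moved : ∀ ρ β → σ β ∈ S → SatBasic unrename (evalTerm unrename ρ) β ≡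
      (¬ SatBasic M (evalTerm M ρ) (markᵗ Neg β))
    unrename-moved ρ β β∈S =
      trans (unrename-∈ _ β β∈S) (cong ¬_ (sym (sat-markᵗ M _ _ Neg ρ β)))

    -- For a role name in S, disjointness turns a plain edge into one outside NegR, which is what
    -- `unrename` takes for R.
    unrename-role : ∀ R → (role (roleName R) ∈ S → SatClause M (disjointness (role (roleName R)))) →
      ∀ {d e} → ⟦_⟧ᵣ M (plainRole R) d e → ⟦_⟧ᵣ unrename R d e
    unrename-role (atomic R) disj {d} {e} r with S? (role R)
    ... | no _    = r
    ... | yes R∈S = λ n → contradiction (disj R∈S (λ { zero → d ; (suc _) → e }) (r ∷ n ∷ [])) λ ()
    unrename-role (inverse R) disj {d} {e} r with S? (role R)
    ... | no _    = r
    -- Variables 0 and 1 are the arguments of the atomic role, hence `e` and `d` in swapped order.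
    ... | yes R∈S = λ n → contradiction (disj R∈S (λ { zero → e ; (suc _) → d }) (r ∷ n ∷ [])) λ ()

    -- One implication is enough, as existential atoms occur only in heads. The role and a positive
    -- filler pass by disjointness; a safe negative filler lies outside S and keeps its meaning.
    unrename-ex : ∀ R L s → SafeLiteral S L →
      (∀ {X} → X ∈ S → Mentions X (ex R L s) → SatClause M (disjointness X)) →
      ∀ ρ → SatAtom M (evalTerm M ρ) (plainAtom (ex R L s)) →
      SatAtom unrename (evalTerm unrename ρ) (ex R L s)
    unrename-ex R (pos A) s safe disj ρ (e , r , p) =
      e , subst (λ d → ⟦_⟧ᵣ unrename R d e) (eval-plainTerm M _ _ ρ s)
            (unrename-role R (λ R∈S → disj R∈S (inj₁ refl)) r) , filler
      where
      filler : conᴵ unrename A e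
      filler with S? (con A)
      ... | no _    = p
      ... | yes A∈S = λ n → contradiction (disj A∈S (inj₂ refl) (λ _ → e) (p ∷ n ∷ [])) λ ()
    unrename-ex R (neg A) s safe disj ρ (e , r , ¬p) =
      e , subst (λ d → ⟦_⟧ᵣ unrename R d e) (eval-plainTerm M _ _ ρ s)
            (unrename-role R (λ R∈S → disj R∈S refl) r) , filler
      where
      filler : ¬ conᴵ unrename A e
      filler with S? (con A)
      ... | no _    = ¬p
      ... | yes A∈S = contradiction A∈S safe

    module _ (ρ : ℕ → Δ M) where

      private
        ⊨ᴹ = SatAtom M (evalTerm M ρ)
        ⊨ᴵ = SatAtom unrename (evalTerm unrename ρ)

      keptBody-unrename : ∀ β → ⊨ᴵ (basic β) →
        Maybe.All (λ γ → ⊨ᴹ (basic γ)) (keptBody β)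
      keptBody-unrename β p with S? (σ β)
      ... | yes _   = Maybe.nothing
      ... | no  β∉S = Maybe.just (subst id (unrename-kept ρ β β∉S) p)

      movedBody-unrename : ∀ β → ⊨ᴵ (basic β) → Maybe.All (λ A → ¬ ⊨ᴹ A) (movedBody β)
      movedBody-unrename β p with S? (σ β)
      ... | yes β∈S = Maybe.just (subst id (unrename-moved ρ β β∈S) p)
      ... | no  _   = Maybe.nothing

      -- Falsity of an atom of S under `unrename` is a doubly negated Neg atom, hence the excluded
      -- middle.
      movedHead-unrename : ExcludedMiddle 0ℓ → ∀ A → ¬ ⊨ᴵ A →
        Maybe.All (λ γ → ⊨ᴹ (basic γ)) (movedHead A)
      movedHead-unrename em (ex _ _ _) n = Maybe.nothing
      movedHead-unrename em (basic β)  n with S? (σ β)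
      ... | yes β∈S = Maybe.just (decidable-stable em (n ∘ subst id (sym (unrename-moved ρ β β∈S))))
      ... | no  _   = Maybe.nothing

      keptHead-unrename : ∀ A → SafeAtom S A →
        (∀ {X} → X ∈ S → Mentions X A → SatClause M (disjointness X)) →
        ¬ ⊨ᴵ A → Maybe.All (λ B → ¬ ⊨ᴹ B) (keptHead A)
      keptHead-unrename (ex R L s) safe disj n =
        Maybe.just (n ∘ unrename-ex R L s safe disj ρ)
      keptHead-unrename (basic β)  safe disj n with S? (σ β)
      ... | yes _   = Maybe.nothing
      ... | no  β∉S = Maybe.just (n ∘ subst id (sym (unrename-kept ρ β β∉S)))

    -- An assignment that violates a clause under `unrename` violates the renamed clause in `M`:
    -- kept atoms retain falsity in the head and truth in the body, and moved atoms change sides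
    -- together with their truth value.
    unrename-sound : ExcludedMiddle 0ℓ → ∀ {DL} → (∀ C → C ∈ DL → All (SafeAtom S) (head C)) →
      SatClauses M (ℛ S? DL) → SatClauses unrename DL
    unrename-sound em safe h C@(H ⟵ B) C∈DL ρ bs = decidable-stable em λ ¬hs →
      let ¬H = Allₚ.¬Any⇒All¬ H ¬hs in
      Allₚ.All¬⇒¬Any
        (Allₚ.++⁺
          (Allₚ.mapMaybe⁺ (Allₚ.map⁺ (All.tabulate λ {A} A∈H →
            keptHead-unrename ρ A (All.lookup (safe C C∈DL) A∈H)
              -- A symbol of S mentioned by a head atom occurs in `C`, so its disjointness clause is
              -- among the renamed ones.
              (λ {X} X∈S X∈A → h _ (ℛ.disjoint C∈DL X∈S (inj₁ (lose A∈H X∈A))))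
              (All.lookup ¬H A∈H))))
          (Allₚ.mapMaybe⁺ (Allₚ.map⁺ (All.map (λ {β} → movedBody-unrename ρ β) bs))))
        (h _ (ℛ.modified C∈DL) ρ
          (Allₚ.++⁺
            (Allₚ.mapMaybe⁺ (Allₚ.map⁺ (All.map (λ {β} → keptBody-unrename ρ β) bs)))
            (Allₚ.mapMaybe⁺ (Allₚ.map⁺ (All.map (λ {A} → movedHead-unrename ρ em A) ¬H)))))

  -- From models of the original clauses to models of the renamed ones

  module _ (J : Interpretation V) where

    star-disjointness : ∀ X → SatClause (star J) (disjointness X)
    star-disjointness (con A)  ρ (p ∷ n ∷ []) = contradiction p n
    star-disjointness (role R) ρ (p ∷ n ∷ []) = contradiction p n

    module _ (ρ : ℕ → Δ J) where

      private
        ⊨* = SatAtom (star J) (evalTerm (star J) ρ)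
        ⊨ᴶ = SatAtom J (evalTerm J ρ)

      -- Exactly one hypothesis is informative: the first if `β` stayed in the body, the second if
      -- it was moved to the head.
      body-star : ExcludedMiddle 0ℓ → ∀ β → Maybe.All (λ γ → ⊨* (basic γ)) (keptBody β) →
        Maybe.All (λ A → ¬ ⊨* A) (movedBody β) → ⊨ᴶ (basic β)
      body-star em β p n with S? (σ β) | p | n
      ... | yes _ | _            | Maybe.just n =
        decidable-stable em (n ∘ subst id (sym (star-Negᵗ J ρ β)))
      ... | no  _ | Maybe.just p | _            = subst id (star-plainᵗ J ρ β) p

      head-star : ∀ A → Maybe.All (λ γ → ⊨* (basic γ)) (movedHead A) →
        Maybe.All (λ B → ¬ ⊨* B) (keptHead A) → ¬ ⊨ᴶ A
      head-star A@(ex _ _ _) p (Maybe.just n) = n ∘ subst id (sym (star-plainAtom J ρ A))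
      head-star (basic β)    p n with S? (σ β) | p | n
      ... | yes _ | Maybe.just p | _            = subst id (star-Negᵗ J ρ β) p
      ... | no  _ | _            | Maybe.just n = n ∘ subst id (sym (star-plainᵗ J ρ β))

    -- With NegX the exact complement of X, moving an atom across the arrow preserves truth: a
    -- violated renamed clause gives a violated original one.
    star-complete : ExcludedMiddle 0ℓ → ∀ {DL} → SatClauses J DL → SatClauses (star J) (ℛ S? DL)
    star-complete em h _ (ℛ.original {C} C∈DL) ρ bs =
      Anyₚ.map⁺ (Any.map (λ {A} → subst id (sym (star-plainAtom J ρ A)))
        (h C C∈DL ρ (All.map (λ {β} → subst id (star-plainᵗ J ρ β)) (Allₚ.map⁻ bs))))
    star-complete em h _ (ℛ.disjoint {X = X} _ _ _) = star-disjointness X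
    star-complete em h _ (ℛ.modified {H ⟵ B} C∈DL) ρ bs = decidable-stable em λ ¬hs →
      let ¬H′ = Allₚ.¬Any⇒All¬ _ ¬hs
          bodies = All.zipWith (λ {β} (p , n) → body-star ρ em β p n)
            ( All-mapMaybe⁻ keptBody B (Allₚ.++⁻ˡ (mapMaybe keptBody B) bs)
            , All-mapMaybe⁻ movedBody B (Allₚ.++⁻ʳ (mapMaybe keptHead H) ¬H′))
          heads = All.zipWith (λ {A} (p , n) → head-star ρ A p n)
            ( All-mapMaybe⁻ movedHead H (Allₚ.++⁻ʳ (mapMaybe keptBody B) bs)
            , All-mapMaybe⁻ keptHead H (Allₚ.++⁻ˡ (mapMaybe keptHead H) ¬H′))
      in Allₚ.All¬⇒¬Any heads (h (H ⟵ B) C∈DL ρ bodies)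

-- Safety of the structural transformation

module _ {V : Vocabulary} {S : Pred (Symbol (Fresh V)) 0ℓ} (Q∉S : ∀ C → con (Q C) ∉ S) where

  -- Only existential restrictions become existential head atoms, so only their fillers are
  -- constrained.
  SafeDisjunct : Disjunct (Fresh V) → Set
  SafeDisjunct (lit L)     = ⊤
  SafeDisjunct (some∃ R L) = SafeLiteral S L
  SafeDisjunct (all∀ R L)  = ⊤

  α-safe : ∀ C → SafeLiteral S (α C)
  α-safe C with positive C
  ... | true  = tt
  ... | false = Q∉S C

  -- The payoff of naming negative literals below ∃: every negative filler is on a fresh name `Q C`,
  -- which is outside S.
  ∃filler-safe : ∀ C → SafeLiteral S (∃filler C)
  ∃filler-safe (lit (pos A)) = tt
  ∃filler-safe (lit (neg A)) = α-safe (lit (neg A))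
  ∃filler-safe top           = α-safe top
  ∃filler-safe bot           = α-safe bot
  ∃filler-safe (C ⊓ D)       = α-safe (C ⊓ D)
  ∃filler-safe (C ⊔ D)       = α-safe (C ⊔ D)
  ∃filler-safe (some∃ R C)   = α-safe (some∃ R C)
  ∃filler-safe (all∀ R C)    = α-safe (all∀ R C)

  disjuncts-safe : ∀ C → All SafeDisjunct (disjuncts C)
  disjuncts-safe (lit L)     = tt ∷ []
  disjuncts-safe top         = tt ∷ []
  disjuncts-safe bot         = []
  disjuncts-safe (C ⊓ D)     = tt ∷ []
  disjuncts-safe (C ⊔ D)     = Allₚ.++⁺ (disjuncts-safe C) (disjuncts-safe D)
  disjuncts-safe (some∃ R C) = ∃filler-safe C ∷ []
  disjuncts-safe (all∀ R C)  = tt ∷ []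

  definitions-safe : ∀ C → All (All SafeDisjunct) (definitions C)
  filler-definitions-safe : ∀ C {L Ds} → Filler C L Ds → All (All SafeDisjunct) Ds

  definitions-safe (lit L)     = []
  definitions-safe top         = []
  definitions-safe bot         = []
  definitions-safe (C ⊓ D)     =
    (tt ∷ disjuncts-safe C) ∷ (tt ∷ disjuncts-safe D) ∷
    Allₚ.++⁺ (definitions-safe C) (definitions-safe D)
  definitions-safe (C ⊔ D)     = Allₚ.++⁺ (definitions-safe C) (definitions-safe D)
  definitions-safe (some∃ R C) = filler-definitions-safe C (∃filler-view C)
  definitions-safe (all∀ R C)  = filler-definitions-safe C (∀filler-view C)

  filler-definitions-safe _ (literal L) = []
  filler-definitions-safe C (named .C)  = (tt ∷ disjuncts-safe C) ∷ definitions-safe C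

  normalise-safe : ∀ X → All (All SafeDisjunct) (normalise X)
  normalise-safe (C ⊑ D) =
    disjuncts-safe (nnf¬ C ⊔ nnf D) ∷ definitions-safe (nnf¬ C ⊔ nnf D)

  disjunctAt-safe : ∀ i D → SafeDisjunct D → All (SafeAtom S) (head (disjunctAt i D))
  disjunctAt-safe i (lit (pos A))    s = tt ∷ []
  disjunctAt-safe i (lit (neg A))    s = []
  disjunctAt-safe i (some∃ R L)      s = s ∷ []
  disjunctAt-safe i (all∀ R (pos A)) s = tt ∷ []
  disjunctAt-safe i (all∀ R (neg A)) s = []

  clausifyFrom-safe : ∀ i {ds} → All SafeDisjunct ds → All (SafeAtom S) (head (clausifyFrom i ds))
  clausifyFrom-safe i []       = []
  clausifyFrom-safe i {D ∷ _} (s ∷ ss) =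
    Allₚ.++⁺ (disjunctAt-safe i D s) (clausifyFrom-safe (suc i) ss)

  roleClause-safe : ∀ X → All (SafeAtom S) (head (roleClause X))
  roleClause-safe (R ⊑ᵣ R′)      = tt ∷ []
  roleClause-safe (transitive R) = tt ∷ []

  Ξ-safe : ∀ 𝒯 C → C ∈ Ξ 𝒯 → All (SafeAtom S) (head C)
  Ξ-safe 𝒯 C = All.lookup (Allₚ.++⁺
    (Allₚ.map⁺ (Allₚ.concat⁺ (Allₚ.map⁺ (All.universal
      (λ X → All.map (clausifyFrom-safe 1) (normalise-safe X)) (inclusions 𝒯)))))
    (Allₚ.map⁺ (All.universal roleClause-safe (roleAxioms 𝒯))))

-- Instance deletion

Q∉symbolsOf : ∀ {V} (𝒜 : List (Assertion V)) C → con (Q C) ∉ symbolsOf 𝒜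
Q∉symbolsOf 𝒜 C Q∈ with ∈-map⁻ (λ β → σ (embed β)) Q∈
... | con A s , _ , ()
... | role R s t , _ , ()

module _ {V : Vocabulary} (I : Interpretation V) where

  sat-groundTerm : ∀ ρ β → SatBasic I (evalTerm I ρ) (groundTerm β) ≡ SatAssertion I β
  sat-groundTerm ρ (con A s)    = refl
  sat-groundTerm ρ (role R s t) = refl

  fact-sound : ∀ β → SatClause I (fact β) → SatAssertion I β
  -- Any assignment serves for a ground clause; `point` provides one.
  fact-sound β h with h (λ _ → point I) []
  ... | here p = subst id (sat-groundTerm _ β) p

  fact-complete : ∀ β → SatAssertion I β → SatClause I (fact β)
  fact-complete β p ρ [] = here (subst id (sym (sat-groundTerm ρ β)) p)

theorem1 : ExcludedMiddle 0ℓ →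
    (V : Vocabulary) (K : KnowledgeBase V) →
    let open KnowledgeBase K in
    Consistent tbox →
    (S? : Decidable (symbolsOf abox)) →
    (D : Assertion V) → D ∈ₗ abox →
    (M : Interpretation (Star (Fresh V))) →
    MinimalModel (NegSet abox) ((K *) S? ∪ ｛ fact (NegA D) ｝) M →
    MinimalInstanceDeletion tbox abox D ((_∈ₗ abox) ∖ Del abox M)
theorem1 em V K _ S? D D∈𝒜 M (M⊨ , M-minimal) = proj₁ , not-entailed , maximal
  where
  open KnowledgeBase K

  I : Interpretation V
  I = restrict (unrename S? M)

  I⊨𝒯 : SatTBox I tbox
  I⊨𝒯 = Ξ-sound _ em tbox
    (unrename-sound S? M em (Ξ-safe (Q∉symbolsOf abox) tbox) λ C → M⊨ C ∘ inj₁ ∘ inj₁)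

  -- Symbols of the ABox are in S, where `unrename` negates Neg; so the assertions of the ABox true
  -- in `I` are those outside `Del`.
  sat-I : ∀ {β} → β ∈ₗ abox → SatAssertion I β ≡ (¬ SatAssertion M (NegA β))
  sat-I {β} β∈𝒜 = trans (sym (sat-embed (unrename S? M) β))
    (trans (unrename-∈ S? M _ (embed β) (∈-map⁺ (λ γ → σ (embed γ)) β∈𝒜))
      (cong ¬_ (sym (sat-mark M Neg _ (embed β)))))

  not-entailed : ¬ Entails tbox ((_∈ₗ abox) ∖ Del abox M) D
  -- Entailment would make D true in `I`, that is, NegD false in `M`, against the added fact.
  not-entailed D-entailed = subst id (sat-I D∈𝒜)
    (D-entailed I I⊨𝒯 λ β (β∈𝒜 , β∉Del) → subst id (sym (sat-I β∈𝒜)) λ n → β∉Del (β∈𝒜 , n))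
    (fact-sound M (NegA D) (M⊨ _ (inj₂ refl)))

  maximal : ¬ (∃[ 𝒜″ ] ((_∈ₗ abox) ∖ Del abox M) ⊂ 𝒜″ × 𝒜″ ⊆ (_∈ₗ abox) × ¬ Entails tbox 𝒜″ D)
  -- No countermodel is extracted from non-entailment. Instead 𝒜″ is shown to entail D: a model `J`
  -- of 𝒯 and 𝒜″ without D would contradict minimality.
  maximal (𝒜″ , (𝒜′⊆𝒜″ , 𝒜″⊈𝒜′) , 𝒜″⊆𝒜 , ¬entailed) = ¬entailed λ J J⊨𝒯 J⊨𝒜″ →
    decidable-stable em λ J⊭D →
      let
        J⁺ = extend J
        J* = star J⁺

        sat-J* : ∀ β → SatAssertion J* (NegA β) ≡ (¬ SatAssertion J β)
        sat-J* β = trans (star-Neg J⁺ _ (embed β)) (cong ¬_ (sat-embed J⁺ β))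

        J*⊨ : SatClauses J* ((K *) S? ∪ ｛ fact (NegA D) ｝)
        J*⊨ = λ where
          C (inj₁ (inj₁ C∈ℛ)) → star-complete S? J⁺ em (Ξ-complete J em tbox J⊨𝒯) C C∈ℛ
          _ (inj₁ (inj₂ (β , _ , refl))) →
            fact-complete J* (ABoxA β) (star-ABox J⁺ _ (embed β))
          _ (inj₂ refl) → fact-complete J* (NegA D) (subst id (sym (sat-J* D)) J⊭D)
      in
      M-minimal (J* , J*⊨ ,
        (λ where
          (p , β , β∈𝒜 , refl) →
            -- If β were not in Del(M), it would survive the deletion, lie in 𝒜″ and hold in `J`,
            -- whereas its Neg atom is true in `J*`.
            (decidable-stable em λ n → subst id (sat-J* β) p
              (J⊨𝒜″ β (𝒜′⊆𝒜″ (β∈𝒜 , n ∘ proj₂)))) ,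
            β , β∈𝒜 , refl) ,
        -- Strictness: every β in 𝒜″ holds in `J`, so its Neg atom fails in `J*`. Under equality of
        -- the Neg atoms it would fail in `M` too, and 𝒜″ would contain nothing new.
        λ M⊆J* → 𝒜″⊈𝒜′ λ {β} β∈𝒜″ → 𝒜″⊆𝒜 β∈𝒜″ ,
          λ (_ , n) → subst id (sat-J* β)
            (proj₁ (M⊆J* (n , β , 𝒜″⊆𝒜 β∈𝒜″ , refl))) (J⊨𝒜″ β β∈𝒜″))
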